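{- Let $P$ be a pattern of length $m$, let $T$ be a text of length $n\le\frac32 m$, and let $0\le k\le m$ be an integer threshold. Suppose that both $T[0..m)$ and $T[n-m..n)$ are $k$-mismatch occurrences of $P$. If there are a positive integer $d\ge 2k$ and a primitive string $Q$ with $|Q|\le m/(8d)$ and $\delta_H(P,Q^\infty[0..m))\le d$, then each of the following holds: \begin{enumerate} \item[(a)] Every $k$-mismatch occurrence of $P$ in $T$ starts at a position that is a multiple of $|Q|$. \item[(b)] The string $T$ satisfies $\delta_H(T,Q^\infty[0..n))\le 3d$. \item[(c)] The set $\mathrm{Occ}^H_k(P,T)$ can be decomposed into $O(d^2)$ arithmetic progressions with difference $|Q|$. \end{enumerate}
   Context: Strings are indexed from $0$; $T[i..j)$ denotes the fragment $T[i]\cdots T[j-1]$. $Q^\infty$ is the infinite concatenation of copies of $Q$. A string is primitive if it cannot be written as $U^r$ for a string $U$ and an integer $r>1$. The Hamming distance $\delta_H$ of two equal-length strings is the number of positions where they differ. $T[i..i+m)$ is a $k$-mismatch occurrence of $P$ (starting at position $i$) if $\delta_H(P,T[i..i+m))\le k$; $\mathrm{Occ}^H_k(P,T)$ is the set of all such positions $i$. An arithmetic progression with difference $q$ is a set $\{a+jq : 0\le j<\ell\}$ with integers $a$ and $\ell>0$. The constant hidden in $O(\cdot)$ is absolute. -}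

module Defs where

open import Data.Empty using (⊥-elim)
open import Data.Fin using (Fin; toℕ; fromℕ<; combine; remQuot)
open import Data.Fin.Properties using (toℕ<n; toℕ-combine; toℕ-injective; toℕ-fromℕ<; combine-remQuot)
open import Data.List using (List)
open import Data.List.Relation.Unary.Any using (Any)
open import Data.List.Relation.Unary.AllPairs using (AllPairs)
open import Data.Nat using (ℕ; zero; suc; _+_; _*_; _≤_; _<_; z≤n; s≤s; NonZero)
open import Data.Nat.DivMod using (_mod_; _%_; m%n<n; [m+kn]%n≡m%n; m<n⇒m%n≡m)
open import Data.Nat.Properties using (<-≤-trans; +-monoʳ-<; +-comm; *-comm)
open import Data.Product using (Σ; Σ-syntax; ∃-syntax; _×_; _,_; proj₁; proj₂)
open import Data.Vec using (Vec; []; lookup; tabulate; zip; count; concat; replicate)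
open import Data.Vec.Relation.Binary.Equality.Cast using (_≈[_]_)
open import Data.Vec.Properties using (lookup-concat; lookup-replicate)
open import Level using (0ℓ)
open import Relation.Binary.Definitions using (DecidableEquality)
open import Relation.Binary.PropositionalEquality
open import Relation.Nullary using (¬_)
open import Relation.Nullary.Decidable using (¬?)
open import Relation.Unary using (Pred; _≐_; _⊥_)

private
  variable
    A : Set
    m n q : ℕ

-- T [ i ⋯+ m ] h  is the fragment T[i..i+m).
_[_⋯+_] : Vec A n → (i m : ℕ) → i + m ≤ n → Vec A m
(T [ i ⋯+ m ]) h =
  tabulate λ j → lookup T (fromℕ< (<-≤-trans (+-monoʳ-< i (toℕ<n j)) h))

_^_ : Vec A n → (r : ℕ) → Vec A (r * n)
U ^ r = concat (replicate r U)

-- The empty string equals its own square, so it is not primitive.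
Primitive : Vec A q → Set
Primitive {A} {q} Q =
  ¬ (∃[ u ] Σ[ U ∈ Vec A u ] ∃[ r ] 1 < r × Σ[ eq ∈ r * u ≡ q ] (U ^ r) ≈[ eq ] Q)

primitive⇒nonZero : (Q : Vec A q) → Primitive Q → NonZero q
primitive⇒nonZero {q = zero}  [] prim = ⊥-elim (prim (0 , [] , 2 , s≤s (s≤s z≤n) , refl , refl))
primitive⇒nonZero {q = suc _} _  _    = _

_^∞ : Vec A q → .{{NonZero q}} → ℕ → A
_^∞ {q = q} Q i = lookup Q (i mod q)

-- Q ^∞[0⋯ n ]  is Q^∞[0..n).
_^∞[0⋯_] : Vec A q → .{{NonZero q}} → (n : ℕ) → Vec A n
Q ^∞[0⋯ n ] = tabulate λ j → (Q ^∞) (toℕ j)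

-- Indexing modulo |Q| agrees with concatenating copies of Q.
^-lookup : (Q : Vec A q) .{{_ : NonZero q}} (r : ℕ) (i : Fin (r * q)) →
           lookup (Q ^ r) i ≡ (Q ^∞) (toℕ i)
^-lookup {q = q} Q r i = begin
  lookup (Q ^ r) i                       ≡⟨ cong (lookup (Q ^ r)) (combine-remQuot {r} q i) ⟨
  lookup (Q ^ r) (combine b j)           ≡⟨ lookup-concat (replicate r Q) b j ⟩
  lookup (lookup (replicate r Q) b) j    ≡⟨ cong (λ X → lookup X j) (lookup-replicate b Q) ⟩
  lookup Q j                             ≡⟨ cong (lookup Q) (toℕ-injective j≡) ⟩
  lookup Q (toℕ i mod q)                 ∎
  where
  open ≡-Reasoning
  b = proj₁ (remQuot {r} q i)
  j = proj₂ (remQuot {r} q i)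
  i≡ : toℕ i ≡ toℕ j + toℕ b * q
  i≡ = begin
    toℕ i                  ≡⟨ cong toℕ (combine-remQuot {r} q i) ⟨
    toℕ (combine b j)      ≡⟨ toℕ-combine b j ⟩
    q * toℕ b + toℕ j      ≡⟨ +-comm (q * toℕ b) (toℕ j) ⟩
    toℕ j + q * toℕ b      ≡⟨ cong (toℕ j +_) (*-comm q (toℕ b)) ⟩
    toℕ j + toℕ b * q      ∎
  j≡ : toℕ j ≡ toℕ (toℕ i mod q)
  j≡ = begin
    toℕ j                        ≡⟨ m<n⇒m%n≡m (toℕ<n j) ⟨
    toℕ j % q                    ≡⟨ [m+kn]%n≡m%n (toℕ j) (toℕ b) q ⟨
    (toℕ j + toℕ b * q) % q      ≡⟨ cong (_% q) i≡ ⟨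
    toℕ i % q                    ≡⟨ toℕ-fromℕ< (m%n<n (toℕ i) q) ⟨
    toℕ (toℕ i mod q)            ∎

module Hamming {A : Set} (_≟_ : DecidableEquality A) where

  δH : Vec A n → Vec A n → ℕ
  δH U V = count (λ (x , y) → ¬? (x ≟ y)) (zip U V)

  Occ : ℕ → Vec A m → Vec A n → Pred ℕ 0ℓ
  Occ {m} {n} k P T i = Σ[ h ∈ i + m ≤ n ] δH P ((T [ i ⋯+ m ]) h) ≤ k

-- Progressions are used only for sets of positions, so the first term may be taken
-- to be a natural number.
record AP : Set where
  field
    start  : ℕ
    size   : ℕ
    size>0 : 0 < size

⟦_⟧ : AP → ℕ → Pred ℕ 0ℓ
⟦ p ⟧ q x = ∃[ j ] j < AP.size p × x ≡ AP.start p + j * q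

-- The set S is the disjoint union of the listed progressions with difference q.
DecomposesInto : Pred ℕ 0ℓ → (q : ℕ) → List AP → Set
DecomposesInto S q ps =
  S ≐ (λ x → Any (λ p → ⟦ p ⟧ q x) ps) × AllPairs (λ p p′ → ⟦ p ⟧ q ⊥ ⟦ p′ ⟧ q) ps

-- (a) Two occurrences, at 0 and at ℓ ≤ m/2, overlap in at least m/2 ≥ 4d|Q| positions. There
-- Q^∞ and its shift by ℓ differ in at most 2(k + d) ≤ 3d positions, so one of the 4d full blocks
-- is free of mismatches; then ℓ is a period of Q^∞, hence so is gcd(|Q|, ℓ), and primitivity
-- gives |Q| ∣ ℓ.
-- (b) By (a) the two outer occurrences, which cover T, are aligned with Q^∞, so each accounts for
-- at most k + d mismatches of T with Q^∞.
-- (c) As long as no mismatch of P with Q^∞ is aligned with a mismatch of T with Q^∞, the distance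
-- of P to the window of T is the number of mismatches of P plus the number of mismatches of T in
-- the window. Hence, along the shifts by |Q|, it changes only when a mismatch of T leaves or
-- enters the window (at most 3d times each) or next to one of at most 3d² collisions, and the
-- occurrences form at most 1 + 6d + 6d² ≤ 13d² runs.

module Submission where

open import Defs
open import Data.Bool using (if_then_else_)
open import Data.Fin using (toℕ; fromℕ<; zero; suc)
open import Data.Fin.Properties using (toℕ-fromℕ<; toℕ<n; toℕ-injective)
open import Data.List using (List; []; _∷_; length)
open import Data.List.Membership.Propositional using (_∈_; lose)
open import Data.List.Relation.Unary.All as All using (All)
open import Data.List.Relation.Unary.AllPairs using ([]; _∷_)
open import Data.List.Relation.Unary.Any using (Any; here; there)
open import Data.Nat using (ℕ; zero; suc; pred; _+_; _*_; _∸_; _≤_; _<_; _≤?_; z≤n; s≤s; NonZero; ≢-nonZero⁻¹)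
open import Data.Nat.Divisibility using (_∣_; divides; quotient)
open import Data.Nat.DivMod using (_%_; _mod_; _/_; m≡m%n+[m/n]*n; m%n<n; m<n⇒m%n≡m; [m+n]%n≡m%n)
open import Data.Nat.GCD using (gcd; gcd-GCD; gcd[m,n]∣m; gcd[m,n]∣n; module Bézout)
open import Data.Nat.Properties
open import Data.Nat.Tactic.RingSolver using (solve-∀)
open import Data.Product using (Σ-syntax; ∃-syntax; _×_; _,_; proj₁; proj₂)
open import Data.Sum using (inj₁; inj₂)
open import Data.Vec using (Vec; []; _∷_; lookup; tabulate; cast)
open import Data.Vec.Properties using (lookup∘tabulate; tabulate∘lookup; tabulate-cong; cast-is-id)
open import Function using (_∘_)
open import Relation.Binary.Definitions using (DecidableEquality)
open import Relation.Binary.PropositionalEquality using (_≡_; _≢_; refl; sym; trans; cong; cong₂; subst; module ≡-Reasoning)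
open import Relation.Nullary using (¬_; Dec; yes; no; contradiction)
open import Relation.Nullary.Decidable using (does)
open import Algebra.Properties.CommutativeSemigroup +-commutativeSemigroup using (interchange)

-- Finite sums of natural numbers.

∑ : ℕ → (ℕ → ℕ) → ℕ
∑ zero    f = 0
∑ (suc n) f = ∑ n f + f n

infix 6 ∑
syntax ∑ n (λ i → e) = ∑[ i < n ] e

private
  variable
    f g : ℕ → ℕ

∑-cong : ∀ n → (∀ i → i < n → f i ≡ g i) → ∑ n f ≡ ∑ n g
∑-cong zero    eq = refl
∑-cong (suc n) eq = cong₂ _+_ (∑-cong n λ i i<n → eq i (m<n⇒m<1+n i<n)) (eq n ≤-refl)

∑-mono : ∀ n → (∀ i → i < n → f i ≤ g i) → ∑ n f ≤ ∑ n g
∑-mono zero    le = z≤n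
∑-mono (suc n) le = +-mono-≤ (∑-mono n λ i i<n → le i (m<n⇒m<1+n i<n)) (le n ≤-refl)

∑-+ : ∀ n (f g : ℕ → ℕ) → ∑[ i < n ] (f i + g i) ≡ ∑ n f + ∑ n g
∑-+ zero    f g = refl
∑-+ (suc n) f g rewrite ∑-+ n f g = interchange (∑ n f) (∑ n g) (f n) (g n)

∑-*ʳ : ∀ n (f : ℕ → ℕ) c → ∑[ i < n ] (f i * c) ≡ ∑ n f * c
∑-*ʳ zero    f c = refl
∑-*ʳ (suc n) f c rewrite ∑-*ʳ n f c = sym (*-distribʳ-+ c (∑ n f) (f n))

∑-*ˡ : ∀ n c (f : ℕ → ℕ) → ∑[ i < n ] (c * f i) ≡ c * ∑ n f
∑-*ˡ zero    c f = sym (*-zeroʳ c)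
∑-*ˡ (suc n) c f rewrite ∑-*ˡ n c f = sym (*-distribˡ-+ c (∑ n f) (f n))

∑-const : ∀ n c → ∑[ i < n ] c ≡ n * c
∑-const zero    c = refl
∑-const (suc n) c rewrite ∑-const n c = +-comm (n * c) c

∑-split : ∀ a b (f : ℕ → ℕ) → ∑ (a + b) f ≡ ∑ a f + (∑[ i < b ] f (a + i))
∑-split a zero    f rewrite +-identityʳ a = sym (+-identityʳ (∑ a f))
∑-split a (suc b) f rewrite +-suc a b | ∑-split a b f = +-assoc (∑ a f) _ _

∑-blocks : ∀ r q (f : ℕ → ℕ) → ∑ (r * q) f ≡ ∑[ b < r ] ∑[ y < q ] f (b * q + y)
∑-blocks zero    q f = refl
∑-blocks (suc r) q f = begin
  ∑ (q + r * q) f                                ≡⟨ cong (λ s → ∑ s f) (+-comm q (r * q)) ⟩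
  ∑ (r * q + q) f                                ≡⟨ ∑-split (r * q) q f ⟩
  ∑ (r * q) f + (∑[ y < q ] f (r * q + y))       ≡⟨ cong (_+ (∑[ y < q ] f (r * q + y))) (∑-blocks r q f) ⟩
  (∑[ b < suc r ] ∑[ y < q ] f (b * q + y))      ∎
  where open ≡-Reasoning

∑-swap : ∀ a b (f : ℕ → ℕ → ℕ) → ∑[ i < a ] ∑[ j < b ] f i j ≡ ∑[ j < b ] ∑[ i < a ] f i j
∑-swap zero    b f = sym (trans (∑-const b 0) (*-zeroʳ b))
∑-swap (suc a) b f rewrite ∑-swap a b f = sym (∑-+ b (λ j → ∑[ i < a ] f i j) (f a))

∑-monoˡ : ∀ {a b} (f : ℕ → ℕ) → a ≤ b → ∑ a f ≤ ∑ b f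
∑-monoˡ {a} f a≤b with c , refl ← m≤n⇒∃[o]m+o≡n a≤b =
  ≤-trans (m≤m+n (∑ a f) _) (≤-reflexive (sym (∑-split a c f)))

∑-shift-≤ : ∀ a b {n} (f : ℕ → ℕ) → a + b ≤ n → ∑[ i < b ] f (a + i) ≤ ∑ n f
∑-shift-≤ a b {n} f a+b≤n = begin
  (∑[ i < b ] f (a + i))            ≤⟨ m≤n+m _ (∑ a f) ⟩
  ∑ a f + (∑[ i < b ] f (a + i))    ≡⟨ ∑-split a b f ⟨
  ∑ (a + b) f                       ≤⟨ ∑-monoˡ f a+b≤n ⟩
  ∑ n f                             ∎
  where open ≤-Reasoning

term≤∑ : ∀ {n i} (f : ℕ → ℕ) → i < n → f i ≤ ∑ n f
term≤∑ {n} {i} f i<n = ≤-trans (m≤n+m (f i) (∑ i f)) (∑-monoˡ f i<n)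

∑≡0⇒term≡0 : ∀ {n i} (f : ℕ → ℕ) → ∑ n f ≡ 0 → i < n → f i ≡ 0
∑≡0⇒term≡0 f ∑≡0 i<n = n≤0⇒n≡0 (≤-trans (term≤∑ f i<n) (≤-reflexive ∑≡0))

-- Each sampled position lies in its own block of length `q`, and the blocks are disjoint. This
-- later bounds how often one fixed pattern position meets text mismatches under shifts by `q`.
∑-sample : ∀ a r q {y n} (f : ℕ → ℕ) → y < q → a + r * q ≤ n →
           ∑[ j < r ] f (a + (j * q + y)) ≤ ∑ n f
∑-sample a r q {y} {n} f y<q a+rq≤n = begin
  (∑[ j < r ] f (a + (j * q + y)))               ≤⟨ ∑-mono r (λ j _ → term≤∑ (λ y → f (a + (j * q + y))) y<q) ⟩
  (∑[ j < r ] ∑[ y < q ] f (a + (j * q + y)))    ≡⟨ ∑-blocks r q (λ i → f (a + i)) ⟨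
  (∑[ i < r * q ] f (a + i))                     ≤⟨ ∑-shift-≤ a (r * q) f a+rq≤n ⟩
  ∑ n f                                          ∎
  where open ≤-Reasoning

-- Periods of sequences and primitivity.

Periodic : {A : Set} → ℕ → (ℕ → A) → Set
Periodic p u = ∀ i → u (i + p) ≡ u i

module _ {A : Set} {u : ℕ → A} where

  periodic-* : ∀ {p} c → Periodic p u → Periodic (c * p) u
  periodic-* zero        per i = cong u (+-identityʳ i)
  periodic-* {p} (suc c) per i = begin
    u (i + (p + c * p))   ≡⟨ cong u (+-assoc i p (c * p)) ⟨
    u (i + p + c * p)     ≡⟨ periodic-* c per (i + p) ⟩
    u (i + p)             ≡⟨ per i ⟩
    u i                   ∎
    where open ≡-Reasoning

  periodic-∸ : ∀ {e p r} → Periodic p u → Periodic r u → e + p ≡ r → Periodic e u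
  periodic-∸ {e} {p} {r} per-p per-r e+p≡r i = begin
    u (i + e)         ≡⟨ per-p (i + e) ⟨
    u (i + e + p)     ≡⟨ cong u (trans (+-assoc i e p) (cong (i +_) e+p≡r)) ⟩
    u (i + r)         ≡⟨ per-r i ⟩
    u i               ∎
    where open ≡-Reasoning

  -- Bézout writes the gcd as a difference of multiples of the two periods; over the naturals the
  -- order of subtraction gives two cases.
  periodic-gcd : ∀ {p r} → Periodic p u → Periodic r u → Periodic (gcd p r) u
  periodic-gcd {p} {r} per-p per-r with Bézout.identity (gcd-GCD p r)
  ... | Bézout.+- x y eq = periodic-∸ (periodic-* y per-r) (periodic-* x per-p) eq
  ... | Bézout.-+ x y eq = periodic-∸ (periodic-* x per-p) (periodic-* y per-r) eq

  periodic-% : ∀ {p} .{{_ : NonZero p}} → Periodic p u → ∀ i → u (i % p) ≡ u i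
  periodic-% {p} per i = begin
    u (i % p)                    ≡⟨ periodic-* (i / p) per (i % p) ⟨
    u (i % p + (i / p) * p)      ≡⟨ cong u (m≡m%n+[m/n]*n i p) ⟨
    u i                          ∎
    where open ≡-Reasoning

module _ {A : Set} {q : ℕ} .{{_ : NonZero q}} (Q : Vec A q) where

  ^∞-periodic : Periodic q (Q ^∞)
  ^∞-periodic i = cong (lookup Q)
    (toℕ-injective (trans (toℕ-fromℕ< _) (trans ([m+n]%n≡m%n i q) (sym (toℕ-fromℕ< _)))))

  ^∞-lookup : ∀ i → (Q ^∞) (toℕ i) ≡ lookup Q i
  ^∞-lookup i = cong (lookup Q)
    (toℕ-injective (trans (toℕ-fromℕ< _) (m<n⇒m%n≡m (toℕ<n i))))

lookup-injective : ∀ {A : Set} {n} {U V : Vec A n} → (∀ i → lookup U i ≡ lookup V i) → U ≡ V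
lookup-injective {U = U} {V} eq =
  trans (sym (tabulate∘lookup U)) (trans (tabulate-cong eq) (tabulate∘lookup V))

-- Entry `i` of the power is `(Q ^∞) (i % g)`, and the period `g` removes the reduction.
^-root : ∀ {A : Set} {g q r} .{{_ : NonZero g}} .{{_ : NonZero q}} (Q : Vec A q) →
         Periodic g (Q ^∞) → (eq : r * g ≡ q) → cast eq ((Q ^∞[0⋯ g ]) ^ r) ≡ Q
^-root {g = g} {r = r} Q per refl = lookup-injective λ i → begin
  lookup (cast refl (U ^ r)) i          ≡⟨ cong (λ (V : Vec _ (r * g)) → lookup V i) (cast-is-id refl (U ^ r)) ⟩
  lookup (U ^ r) i                      ≡⟨ ^-lookup U r i ⟩
  lookup U (toℕ i mod g)                ≡⟨ lookup∘tabulate _ (toℕ i mod g) ⟩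
  (Q ^∞) (toℕ (toℕ i mod g))            ≡⟨ cong (Q ^∞) (toℕ-fromℕ< (m%n<n (toℕ i) g)) ⟩
  (Q ^∞) (toℕ i % g)                    ≡⟨ periodic-% per (toℕ i) ⟩
  (Q ^∞) (toℕ i)                        ≡⟨ ^∞-lookup Q i ⟩
  lookup Q i                            ∎
  where
  open ≡-Reasoning
  U = Q ^∞[0⋯ g ]

-- The gcd of `q` and `ℓ` is a period of `Q ^∞`. If it divides `q` with quotient 1, it is `q` and
-- divides `ℓ`; a larger quotient would make `Q` a proper power of its prefix.
primitive-period : ∀ {A : Set} {q ℓ} .{{_ : NonZero q}} (Q : Vec A q) → Primitive Q →
                   Periodic ℓ (Q ^∞) → q ∣ ℓ
primitive-period {q = q} {ℓ} Q prim per with gcd[m,n]∣m q ℓ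
... | divides zero          eq = contradiction eq (≢-nonZero⁻¹ q)
... | divides 1             eq =
  subst (_∣ ℓ) (trans (sym (+-identityʳ _)) (sym eq)) (gcd[m,n]∣n q ℓ)
... | divides r@(suc (suc _)) eq with gcd q ℓ | periodic-gcd (^∞-periodic Q) per
...   | zero  | _ = contradiction (trans eq (*-zeroʳ r)) (≢-nonZero⁻¹ q)
...   | suc g | per-g =
  contradiction (suc g , Q ^∞[0⋯ suc g ] , r , s≤s (s≤s z≤n) , sym eq , ^-root {r = r} Q per-g (sym eq)) prim

-- Splitting a decidable set of multiples of `q` into maximal runs.

module _ {D : ℕ → Set} (D? : ∀ j → Dec (D j)) (q : ℕ) .{{_ : NonZero q}} where

  MultiplesUpTo : ℕ → ℕ → Set
  MultiplesUpTo N x = ∃[ j ] j ≤ N × D j × x ≡ j * q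

  private
    -- Separates the newly added position from all progressions built before; `q` is cancelled,
    -- being nonzero.
    fresh : ∀ {N x} → MultiplesUpTo N x → x ≢ suc N * q
    fresh {N} (j , j≤N , _ , x≡) x≡′ =
      <-irrefl (*-cancelʳ-≡ j (suc N) q (trans (sym x≡) x≡′)) (s≤s j≤N)

    weaken : ∀ {N x} → MultiplesUpTo N x → MultiplesUpTo (suc N) x
    weaken (j , j≤N , Dj , x≡) = j , m≤n⇒m≤1+n j≤N , Dj , x≡

    LastRun : ℕ → List AP → Set
    LastRun N ps = ∃[ a ] ∃[ p ] Σ[ ps′ ∈ List AP ]
      ps ≡ p ∷ ps′ × AP.start p ≡ a * q × a + AP.size p ≡ suc N

    singleton : ℕ → AP
    singleton x = record { start = x ; size = 1 ; size>0 = s≤s z≤n }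

    extend₁ : AP → AP
    extend₁ p = record { start = AP.start p ; size = suc (AP.size p) ; size>0 = s≤s z≤n }

    -- LastRun lets the next step either lengthen the last run or open a new one.
    runs′ : ∀ N (e : ℕ → ℕ) → (∀ j → j < N → ¬ D j → D (suc j) → 1 ≤ e j) →
           Σ[ ps ∈ List AP ] DecomposesInto (MultiplesUpTo N) q ps
             × length ps ≤ suc (∑ N e) × (D N → LastRun N ps)
    runs′ zero e jump with D? 0
    ... | no ¬D0 = [] , (((λ { (.0 , z≤n , D0 , _) → contradiction D0 ¬D0 }) , λ ()) , []) , z≤n ,
                   λ D0 → contradiction D0 ¬D0
    ... | yes D0 = singleton 0 ∷ [] ,
      (((λ { (.0 , z≤n , _ , x≡) → here (0 , s≤s z≤n , x≡) })
       , λ { (here (zero , _ , x≡)) → 0 , z≤n , D0 , x≡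
           ; (here (suc _ , s≤s () , _)) }) , All.[] ∷ []) ,
      s≤s z≤n , λ _ → 0 , singleton 0 , [] , refl , refl , refl
    runs′ (suc N) e jump
      with runs′ N e (λ j j<N → jump j (m<n⇒m<1+n j<N)) | D? (suc N)
    ... | ps , ((sub , sup) , disj) , len , _ | no ¬D′ =
      ps , (((λ { (j , j≤ , Dj , x≡) → sub (j , ≤-pred (≤∧≢⇒< j≤ (λ { refl → ¬D′ Dj })) , Dj , x≡) })
            , weaken ∘ sup) , disj) ,
      ≤-trans len (s≤s (m≤m+n (∑ N e) (e N))) ,
      λ D′ → contradiction D′ ¬D′
    ... | ps , ((sub , sup) , disj) , len , last | yes D′ with D? N
    ...   | no ¬D = singleton (suc N * q) ∷ ps , ((⊆ , ⊇) , All.tabulate apart ∷ disj) ,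
      -- `D` fails at `N` and holds at `suc N`, so `jump` gives `1 ≤ e N`, which pays for the new
      -- run.
      s≤s (≤-trans len (≤-trans (≤-reflexive (+-comm 1 _)) (+-monoʳ-≤ (∑ N e) (jump N ≤-refl ¬D D′)))) ,
      λ _ → suc N , singleton (suc N * q) , ps , refl , refl , +-comm (suc N) 1
      where
      ⊆ : ∀ {x} → MultiplesUpTo (suc N) x → Any (λ p → ⟦ p ⟧ q x) (singleton (suc N * q) ∷ ps)
      ⊆ (j , j≤ , Dj , x≡) with m≤n⇒m<n∨m≡n j≤
      ... | inj₁ j<   = there (sub (j , ≤-pred j< , Dj , x≡))
      ... | inj₂ refl = here (0 , s≤s z≤n , trans x≡ (sym (+-identityʳ _)))
      ⊇ : ∀ {x} → Any (λ p → ⟦ p ⟧ q x) (singleton (suc N * q) ∷ ps) → MultiplesUpTo (suc N) x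
      ⊇ (here (zero , _ , x≡))       = suc N , ≤-refl , D′ , trans x≡ (+-identityʳ _)
      ⊇ (here (suc _ , s≤s () , _))
      ⊇ (there x∈)                   = weaken (sup x∈)
      apart : ∀ {p} → p ∈ ps → ∀ {x} → ¬ (⟦ singleton (suc N * q) ⟧ q x × ⟦ p ⟧ q x)
      apart p∈ ((zero , _ , x≡) , x∈p)      = fresh (sup (lose p∈ x∈p)) (trans x≡ (+-identityʳ _))
      apart p∈ ((suc _ , s≤s () , _) , _)
    ...   | yes D with last D
    ...     | a , p , ps′ , refl , start≡ , end≡ with disj
    ...       | p⊥ ∷ disj′ =
      extend₁ p ∷ ps′ , ((⊆ , ⊇) , All.tabulate apart ∷ disj′) ,
      ≤-trans len (s≤s (m≤m+n (∑ N e) (e N))) ,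
      λ _ → a , extend₁ p , ps′ , refl , start≡ , trans (+-suc a _) (cong suc end≡)
      where
      new : AP.start p + AP.size p * q ≡ suc N * q
      new = trans (cong (_+ AP.size p * q) start≡)
                  (trans (sym (*-distribʳ-+ q a (AP.size p))) (cong (_* q) end≡))
      ⊆ : ∀ {x} → MultiplesUpTo (suc N) x → Any (λ p → ⟦ p ⟧ q x) (extend₁ p ∷ ps′)
      ⊆ (j , j≤ , Dj , x≡) with m≤n⇒m<n∨m≡n j≤
      ... | inj₂ refl = here (AP.size p , ≤-refl , trans x≡ (sym new))
      ... | inj₁ j< with sub (j , ≤-pred j< , Dj , x≡)
      ...   | here (i , i< , x≡′) = here (i , m<n⇒m<1+n i< , x≡′)
      ...   | there x∈            = there x∈
      ⊇ : ∀ {x} → Any (λ p → ⟦ p ⟧ q x) (extend₁ p ∷ ps′) → MultiplesUpTo (suc N) x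
      ⊇ (there x∈) = weaken (sup (there x∈))
      ⊇ (here (i , i< , x≡)) with m≤n⇒m<n∨m≡n (≤-pred i<)
      ... | inj₁ i<′  = weaken (sup (here (i , i<′ , x≡)))
      ... | inj₂ refl = suc N , ≤-refl , D′ , trans x≡ new
      apart : ∀ {p′} → p′ ∈ ps′ → ∀ {x} → ¬ (⟦ extend₁ p ⟧ q x × ⟦ p′ ⟧ q x)
      apart p′∈ ((i , i< , x≡) , x∈p′) with m≤n⇒m<n∨m≡n (≤-pred i<)
      ... | inj₁ i<′  = All.lookup p⊥ p′∈ ((i , i<′ , x≡) , x∈p′)
      ... | inj₂ refl = fresh (sup (there (lose p′∈ x∈p′))) (trans x≡ new)

  -- A run opens either at 0, which accounts for the `suc`, or where `D` turns from false to true,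
  -- which costs at least one unit of `e`.
  runs : ∀ N (e : ℕ → ℕ) → (∀ j → j < N → ¬ D j → D (suc j) → 1 ≤ e j) →
         Σ[ ps ∈ List AP ] DecomposesInto (MultiplesUpTo N) q ps × length ps ≤ suc (∑ N e)
  runs N e jump with ps , dec , len , _ ← runs′ N e jump = ps , dec , len

-- Strings as total functions on positions.

-- The default `a` frees index arithmetic from bound proofs; the lemmas below speak only of
-- positions inside the string.
extend : {A : Set} {n : ℕ} → A → Vec A n → ℕ → A
extend a []      _       = a
extend a (x ∷ U) zero    = x
extend a (x ∷ U) (suc i) = extend a U i

module _ {A : Set} (a : A) where

  extend-lookup : ∀ {n} (U : Vec A n) i → extend a U (toℕ i) ≡ lookup U i
  extend-lookup (x ∷ U) zero    = refl
  extend-lookup (x ∷ U) (suc i) = extend-lookup U i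

  extend-fromℕ< : ∀ {n i} (U : Vec A n) (i<n : i < n) → lookup U (fromℕ< i<n) ≡ extend a U i
  extend-fromℕ< U i<n =
    trans (sym (extend-lookup U (fromℕ< i<n))) (cong (extend a U) (toℕ-fromℕ< i<n))

  extend-tabulate : ∀ {n i} (u : ℕ → A) → i < n → extend a (tabulate {n = n} (u ∘ toℕ)) i ≡ u i
  extend-tabulate {i = i} u i<n = begin
    extend a U i                ≡⟨ extend-fromℕ< U i<n ⟨
    lookup U (fromℕ< i<n)       ≡⟨ lookup∘tabulate (u ∘ toℕ) (fromℕ< i<n) ⟩
    u (toℕ (fromℕ< i<n))        ≡⟨ cong u (toℕ-fromℕ< i<n) ⟩
    u i                         ∎
    where
    open ≡-Reasoning
    U = tabulate (u ∘ toℕ)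

  extend-fragment : ∀ {n} (T : Vec A n) i m (h : i + m ≤ n) {x} → x < m →
                    extend a ((T [ i ⋯+ m ]) h) x ≡ extend a T (i + x)
  extend-fragment T i m h {x} x<m = begin
    extend a ((T [ i ⋯+ m ]) h) x                   ≡⟨ extend-fromℕ< ((T [ i ⋯+ m ]) h) x<m ⟨
    lookup ((T [ i ⋯+ m ]) h) (fromℕ< x<m)          ≡⟨ lookup∘tabulate _ (fromℕ< x<m) ⟩
    lookup T (fromℕ< _)                             ≡⟨ extend-fromℕ< T bound ⟩
    extend a T (i + toℕ (fromℕ< x<m))               ≡⟨ cong (λ y → extend a T (i + y)) (toℕ-fromℕ< x<m) ⟩
    extend a T (i + x)                              ∎
    where
    open ≡-Reasoning
    bound = <-≤-trans (+-monoʳ-< i (toℕ<n (fromℕ< x<m))) h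

-- Hamming distance as a sum of mismatch indicators.

module Mismatches {A : Set} (_≟_ : DecidableEquality A) where
  open Hamming _≟_

  mis : A → A → ℕ
  mis x y = if does (x ≟ y) then 0 else 1

  -- The middle letter `y` comes first in both terms on the right, which fits comparisons of pattern
  -- with text and of either with `w` without appeal to symmetry.
  mis-triangle : ∀ x y z → mis x z ≤ mis y x + mis y z
  mis-triangle x y z with x ≟ z | y ≟ x | y ≟ z
  ... | yes _   | _        | _        = z≤n
  ... | no _    | no _     | _        = s≤s z≤n
  ... | no _    | yes _    | no _     = ≤-refl
  ... | no x≢z  | yes refl | yes refl = contradiction refl x≢z

  mis≡0 : ∀ {x y} → mis x y ≡ 0 → x ≡ y
  mis≡0 {x} {y} _  with x ≟ y
  mis≡0         _  | yes x≡y = x≡y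
  mis≡0         () | no _

  -- A zero product means that `x` or `y` equals `z`, so only the other one can contribute.
  mis-additive : ∀ x y z → mis x z * mis y z ≡ 0 → mis x y ≡ mis x z + mis y z
  mis-additive x y z _ with x ≟ z | y ≟ z | x ≟ y
  mis-additive x y z _  | yes refl | yes refl | yes _    = refl
  mis-additive x y z _  | yes refl | yes refl | no x≢x   = contradiction refl x≢x
  mis-additive x y z _  | yes refl | no y≢y   | yes refl = contradiction refl y≢y
  mis-additive x y z _  | yes refl | no _     | no _     = refl
  mis-additive x y z _  | no x≢x   | yes refl | yes refl = contradiction refl x≢x
  mis-additive x y z _  | no _     | yes refl | no _     = refl
  mis-additive x y z () | no _     | no _     | _

  δH-∑ : ∀ {n} a (U V : Vec A n) → δH U V ≡ ∑[ i < n ] mis (extend a U i) (extend a V i)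
  δH-∑ a []      []      = refl
  -- `∑` peels off its last term but vectors grow at the head, so the first term is split off.
  δH-∑ {suc n} a (x ∷ U) (y ∷ V) = trans (head-tail (δH-∑ a U V))
    (sym (∑-split 1 n (λ i → mis (extend a (x ∷ U) i) (extend a (y ∷ V) i))))
    where
    head-tail : ∀ {s} → δH U V ≡ s → δH (x ∷ U) (y ∷ V) ≡ mis x y + s
    head-tail eq with x ≟ y
    ... | yes _ = eq
    ... | no _  = cong suc eq

  δH-^∞ : ∀ {n q} .{{_ : NonZero q}} a (U : Vec A n) (Q : Vec A q) →
          δH U (Q ^∞[0⋯ n ]) ≡ ∑[ i < n ] mis (extend a U i) ((Q ^∞) i)
  δH-^∞ {n} a U Q = trans (δH-∑ a U (Q ^∞[0⋯ n ]))
    (∑-cong n λ i i<n → cong (mis (extend a U i)) (extend-tabulate a (Q ^∞) i<n))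

  δH-fragment : ∀ {m n} a (P : Vec A m) (T : Vec A n) i (h : i + m ≤ n) →
                δH P ((T [ i ⋯+ m ]) h) ≡ ∑[ x < m ] mis (extend a P x) (extend a T (i + x))
  δH-fragment {m} a P T i h = trans (δH-∑ a P ((T [ i ⋯+ m ]) h))
    (∑-cong m λ x x<m → cong (mis (extend a P x)) (extend-fragment a T i m h x<m))

  -- Occurrences of a pattern close to a periodic sequence.

  module NearPeriodic {q : ℕ} .{{_ : NonZero q}} (p t w : ℕ → A) (per : Periodic q w)
                      (m n k d : ℕ) (p-near : ∑[ x < m ] mis (p x) (w x) ≤ d) where

    dist : ℕ → ℕ
    dist i = ∑[ x < m ] mis (p x) (t (i + x))

    private
      π μ : ℕ → ℕ
      π x = mis (p x) (w x)
      μ x = mis (t x) (w x)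

      0<q : 0 < q
      0<q = n≢0⇒n>0 (≢-nonZero⁻¹ q)

    -- Triangle inequality through the pattern. The window is compared with `w` read from position
    -- 0, as no alignment of `i` is assumed.
    window-near : ∀ {i} → dist i ≤ k → ∑[ x < m ] mis (t (i + x)) (w x) ≤ k + d
    window-near {i} occ = begin
      (∑[ x < m ] mis (t (i + x)) (w x))                       ≤⟨ ∑-mono m (λ x _ → mis-triangle (t (i + x)) (p x) (w x)) ⟩
      (∑[ x < m ] (mis (p x) (t (i + x)) + mis (p x) (w x)))   ≡⟨ ∑-+ m _ _ ⟩
      dist i + ∑ m π                                           ≤⟨ +-mono-≤ occ p-near ⟩
      k + d                                                    ∎
      where open ≤-Reasoning

    private
      regroup : 2 * k ≤ d → (k + d) + (k + d) ≤ 3 * d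
      regroup 2k≤d = ≤-trans (≤-reflexive (double k d)) (+-monoˡ-≤ (2 * d) 2k≤d)
        where
        double : ∀ k d → (k + d) + (k + d) ≡ 2 * k + 2 * d
        double = solve-∀

    -- Triangle inequality through the text letter at `ℓ + y`: the occurrence at `ℓ` compares it
    -- with `w y`, the one at 0 with `w (ℓ + y)`.
    overlap-near : ∀ {ℓ L} → 2 * k ≤ d → ℓ + L ≡ m → dist 0 ≤ k → dist ℓ ≤ k →
                   ∑[ y < L ] mis (w y) (w (ℓ + y)) ≤ 3 * d
    overlap-near {ℓ} {L} 2k≤d refl occ₀ occ = begin
      (∑[ y < L ] mis (w y) (w (ℓ + y)))                             ≤⟨ ∑-mono L (λ y _ → mis-triangle (w y) (t (ℓ + y)) (w (ℓ + y))) ⟩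
      (∑[ y < L ] (mis (t (ℓ + y)) (w y) + μ (ℓ + y)))               ≡⟨ ∑-+ L _ _ ⟩
      (∑[ y < L ] mis (t (ℓ + y)) (w y)) + (∑[ y < L ] μ (ℓ + y))    ≤⟨ +-mono-≤ (∑-monoˡ _ (m≤n+m L ℓ)) (∑-shift-≤ ℓ L μ ≤-refl) ⟩
      (∑[ y < m ] mis (t (ℓ + y)) (w y)) + ∑ m μ                     ≤⟨ +-mono-≤ (window-near occ) (window-near occ₀) ⟩
      (k + d) + (k + d)                                              ≤⟨ regroup 2k≤d ⟩
      3 * d                                                          ∎
      where open ≤-Reasoning

    -- The mismatch indicator of `w` against its shift has period `q`, so all `4 * d` blocks carry
    -- the same count; a total of at most `3 * d` forces that count to be 0.
    occurrence-period : ∀ {ℓ L} → 0 < d → 2 * k ≤ d → ℓ + L ≡ m → 4 * d * q ≤ L →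
                        dist 0 ≤ k → dist ℓ ≤ k → Periodic ℓ w
    occurrence-period {ℓ} {L} 0<d 2k≤d ℓ+L≡m 4dq≤L occ₀ occ i = begin
      w (i + ℓ)                        ≡⟨ per-shift ℓ i ⟨
      w (i % q + ℓ)                    ≡⟨ cong w (+-comm (i % q) ℓ) ⟩
      w (ℓ + i % q)                    ≡⟨ mis≡0 (∑≡0⇒term≡0 shiftMis block≡0 (m%n<n i q)) ⟨
      w (i % q)                        ≡⟨ periodic-% per i ⟩
      w i                              ∎
      where
      open ≡-Reasoning
      shiftMis : ℕ → ℕ
      shiftMis y = mis (w y) (w (ℓ + y))
      per-shift : ∀ ℓ i → w (i % q + ℓ) ≡ w (i + ℓ)
      per-shift ℓ = periodic-% {u = λ i → w (i + ℓ)}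
        λ i → trans (cong w (swap i q ℓ)) (per (i + ℓ))
        where
        swap : ∀ i q ℓ → i + q + ℓ ≡ i + ℓ + q
        swap = solve-∀
      block : ∀ b y → shiftMis (b * q + y) ≡ shiftMis y
      block b y = trans (cong shiftMis (+-comm (b * q) y)) (periodic-* {u = shiftMis} b
        (λ i → cong₂ mis (per i) (trans (cong w (sym (+-assoc ℓ i q))) (per (ℓ + i)))) y)
      blocks : ∑ (4 * d * q) shiftMis ≡ 4 * d * ∑ q shiftMis
      blocks = begin
        ∑ (4 * d * q) shiftMis                               ≡⟨ ∑-blocks (4 * d) q shiftMis ⟩
        (∑[ b < 4 * d ] ∑[ y < q ] shiftMis (b * q + y))     ≡⟨ ∑-cong (4 * d) (λ b _ → ∑-cong q λ y _ → block b y) ⟩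
        (∑[ b < 4 * d ] ∑ q shiftMis)                        ≡⟨ ∑-const (4 * d) (∑ q shiftMis) ⟩
        4 * d * ∑ q shiftMis                                 ∎
      few : 4 * d * ∑ q shiftMis ≤ 3 * d
      few = ≤-trans (≤-reflexive (sym blocks))
        (≤-trans (∑-monoˡ shiftMis 4dq≤L) (overlap-near 2k≤d ℓ+L≡m occ₀ occ))
      4d≰3d : ¬ 4 * d ≤ 3 * d
      -- `4 * d` unfolds to `d + 3 * d`; cancelling `3 * d` leaves `d ≤ 0`.
      4d≰3d le = <-irrefl refl (<-≤-trans 0<d (+-cancelʳ-≤ (3 * d) d 0 le))
      block≡0 : ∑ q shiftMis ≡ 0
      block≡0 with ∑ q shiftMis | few
      ... | zero  | _  = refl
      ... | suc s | le = contradiction (≤-trans (m≤m*n (4 * d) (suc s)) le) 4d≰3d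

    -- The text is cut at `ℓ`: the first part lies in the window at 0 since `ℓ ≤ m`, the rest is the
    -- window at `ℓ`, which the period `ℓ` aligns with `w`.
    text-near : ∀ {ℓ} → 2 * k ≤ d → ℓ + m ≡ n → ℓ ≤ m → Periodic ℓ w →
                dist 0 ≤ k → dist ℓ ≤ k → ∑ n μ ≤ 3 * d
    text-near {ℓ} 2k≤d refl ℓ≤m per-ℓ occ₀ occ = begin
      ∑ (ℓ + m) μ                          ≡⟨ ∑-split ℓ m μ ⟩
      ∑ ℓ μ + (∑[ x < m ] μ (ℓ + x))       ≤⟨ +-mono-≤ (≤-trans (∑-monoˡ μ ℓ≤m) (window-near occ₀)) (≤-trans (≤-reflexive (∑-cong m λ x _ → aligned x)) (window-near occ)) ⟩
      (k + d) + (k + d)                    ≤⟨ regroup 2k≤d ⟩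
      3 * d                                ∎
      where
      open ≤-Reasoning
      aligned : ∀ x → μ (ℓ + x) ≡ mis (t (ℓ + x)) (w x)
      aligned x = cong (mis (t (ℓ + x))) (trans (cong w (+-comm ℓ x)) (per-ℓ x))

    -- Change of the distance under shifts by `q`.

    private
      collisions : ℕ → ℕ
      collisions i = ∑[ x < m ] (π x * μ (i + x))

    -- The period `i` lets pattern and window be compared with the same letters of `w`; without
    -- collisions `mis-additive` applies at every position.
    dist-additive : ∀ {i} → Periodic i w → collisions i ≡ 0 →
                    dist i ≡ ∑ m π + (∑[ x < m ] μ (i + x))
    dist-additive {i} per-i none = trans (∑-cong m λ x x<m →
        trans (mis-additive (p x) (t (i + x)) (w x)
                (trans (cong (π x *_) (sym (aligned x))) (∑≡0⇒term≡0 _ none x<m)))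
              (cong (π x +_) (sym (aligned x))))
      (∑-+ m π _)
      where
      aligned : ∀ x → μ (i + x) ≡ mis (t (i + x)) (w x)
      aligned x = cong (mis (t (i + x))) (trans (cong w (+-comm i x)) (per-i x))

    -- The mismatches leaving and entering the window, and the collisions of mismatches
    -- of p with mismatches of t, when the window moves from j q to (j + 1) q.
    events : ℕ → ℕ
    events j = ((∑[ y < q ] μ (j * q + y)) + (∑[ y < q ] μ (m + (j * q + y))))
             + (collisions (j * q) + collisions (suc j * q))

    dist-constant : ∀ j → events j ≡ 0 → dist (j * q) ≡ dist (suc j * q)
    dist-constant j none = begin
      dist (j * q)                                    ≡⟨ dist-additive (periodic-* j per) (m+n≡0⇒m≡0 _ noCollisions) ⟩
      ∑ m π + (∑[ x < m ] μ (j * q + x))              ≡⟨ cong (∑ m π +_) same-window ⟩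
      ∑ m π + (∑[ x < m ] μ (suc j * q + x))          ≡⟨ dist-additive (periodic-* (suc j) per) (m+n≡0⇒n≡0 (collisions (j * q)) noCollisions) ⟨
      dist (suc j * q)                                ∎
      where
      open ≡-Reasoning
      noMoves      = m+n≡0⇒m≡0 _ none
      noCollisions = m+n≡0⇒n≡0 ((∑[ y < q ] μ (j * q + y)) + (∑[ y < q ] μ (m + (j * q + y)))) none
      noLeaving    = m+n≡0⇒m≡0 _ noMoves
      noEntering   = m+n≡0⇒n≡0 (∑[ y < q ] μ (j * q + y)) noMoves
      entering : ∀ m s y → s + (m + y) ≡ m + (s + y)
      entering = solve-∀
      moved : ∀ q s x → s + (q + x) ≡ (q + s) + x
      moved = solve-∀
      same-window : ∑[ x < m ] μ (j * q + x) ≡ ∑[ x < m ] μ (suc j * q + x)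
      -- Both windows lie in the stretch of length `m + q` from `j * q`: the entering positions are
      -- appended and the leaving ones dropped, all free of mismatches.
      same-window = begin
        (∑[ x < m ] μ (j * q + x))
          ≡⟨ +-identityʳ _ ⟨
        (∑[ x < m ] μ (j * q + x)) + 0
          ≡⟨ cong ((∑[ x < m ] μ (j * q + x)) +_) noEntering ⟨
        (∑[ x < m ] μ (j * q + x)) + (∑[ y < q ] μ (m + (j * q + y)))
          ≡⟨ cong ((∑[ x < m ] μ (j * q + x)) +_) (∑-cong q λ y _ → cong μ (entering m (j * q) y)) ⟨
        (∑[ x < m ] μ (j * q + x)) + (∑[ y < q ] μ (j * q + (m + y)))
          ≡⟨ ∑-split m q (λ x → μ (j * q + x)) ⟨
        (∑[ x < m + q ] μ (j * q + x))
          ≡⟨ cong (λ s → ∑[ x < s ] μ (j * q + x)) (+-comm m q) ⟩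
        (∑[ x < q + m ] μ (j * q + x))
          ≡⟨ ∑-split q m (λ x → μ (j * q + x)) ⟩
        (∑[ y < q ] μ (j * q + y)) + (∑[ x < m ] μ (j * q + (q + x)))
          ≡⟨ cong (_+ (∑[ x < m ] μ (j * q + (q + x)))) noLeaving ⟩
        (∑[ x < m ] μ (j * q + (q + x)))
          ≡⟨ ∑-cong m (λ x _ → cong μ (moved q (j * q) x)) ⟩
        (∑[ x < m ] μ (suc j * q + x))
          ∎

    module _ {J b : ℕ} (fits : J * q + m ≡ n) (t-near : ∑ n μ ≤ b) where

      private
        Jq+x<n : ∀ {x} → x < m → suc x + J * q ≤ n
        Jq+x<n {x} x<m = ≤-trans (≤-reflexive (+-comm (suc x) (J * q)))
          (≤-trans (+-monoʳ-≤ (J * q) x<m) (≤-reflexive fits))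

      -- After swapping the sums, each of the at most `d` pattern mismatches meets at most `b` text
      -- mismatches. The parameter `c` serves the shifts before and after each step.
      collisions-total : (c : ℕ → ℕ) → (∀ x → x < m → ∑[ j < J ] μ (c j + x) ≤ b) →
                         ∑[ j < J ] collisions (c j) ≤ d * b
      collisions-total c few = begin
        (∑[ j < J ] ∑[ x < m ] (π x * μ (c j + x)))       ≡⟨ ∑-swap J m (λ j x → π x * μ (c j + x)) ⟩
        (∑[ x < m ] ∑[ j < J ] (π x * μ (c j + x)))       ≡⟨ ∑-cong m (λ x _ → ∑-*ˡ J (π x) (λ j → μ (c j + x))) ⟩
        (∑[ x < m ] (π x * (∑[ j < J ] μ (c j + x))))     ≤⟨ ∑-mono m (λ x x<m → *-monoʳ-≤ (π x) (few x x<m)) ⟩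
        (∑[ x < m ] (π x * b))                            ≡⟨ ∑-*ʳ m π b ⟩
        ∑ m π * b                                         ≤⟨ *-monoˡ-≤ b p-near ⟩
        d * b                                             ∎
        where open ≤-Reasoning

      events-total : ∑ J events ≤ (b + b) + (d * b + d * b)
      events-total = begin
        ∑ J events
          ≡⟨ ∑-+ J _ _ ⟩
        (∑[ j < J ] ((∑[ y < q ] μ (j * q + y)) + (∑[ y < q ] μ (m + (j * q + y)))))
          + (∑[ j < J ] (collisions (j * q) + collisions (suc j * q)))
          ≡⟨ cong₂ _+_ (∑-+ J _ _) (∑-+ J _ _) ⟩
        ((∑[ j < J ] ∑[ y < q ] μ (j * q + y)) + (∑[ j < J ] ∑[ y < q ] μ (m + (j * q + y))))
          + ((∑[ j < J ] collisions (j * q)) + (∑[ j < J ] collisions (suc j * q)))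
          ≤⟨ +-mono-≤ (+-mono-≤ leaving entering)
                      (+-mono-≤ (collisions-total (_* q) before) (collisions-total (λ j → suc j * q) after)) ⟩
        (b + b) + (d * b + d * b)
          ∎
        where
        open ≤-Reasoning
        -- The leaving blocks tile the first `J * q` positions, the entering blocks the last
        -- `J * q`.
        leaving : ∑[ j < J ] ∑[ y < q ] μ (j * q + y) ≤ b
        leaving = ≤-trans (≤-reflexive (sym (∑-blocks J q μ)))
          (≤-trans (∑-monoˡ μ (≤-trans (m≤m+n (J * q) m) (≤-reflexive fits))) t-near)
        entering : ∑[ j < J ] ∑[ y < q ] μ (m + (j * q + y)) ≤ b
        entering = ≤-trans (≤-reflexive (sym (∑-blocks J q (λ i → μ (m + i)))))
          (≤-trans (∑-shift-≤ m (J * q) μ (≤-reflexive (trans (+-comm m (J * q)) fits))) t-near)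
        before : ∀ x → x < m → ∑[ j < J ] μ (j * q + x) ≤ b
        before x x<m = ≤-trans (≤-reflexive (∑-cong J λ j _ → cong μ (rearrange (j * q) x)))
          (≤-trans (∑-sample x J q μ 0<q (<⇒≤ (Jq+x<n x<m))) t-near)
          where
          rearrange : ∀ s x → s + x ≡ x + (s + 0)
          rearrange = solve-∀
        after : ∀ x → x < m → ∑[ j < J ] μ (suc j * q + x) ≤ b
        -- Blocks starting at `q + x` could run past `n`. Blocks starting at `suc x` stay inside,
        -- and the wanted positions are their last ones, at offset `pred q`.
        after x x<m = ≤-trans (≤-reflexive (∑-cong J λ j _ → cong μ (next j)))
          (≤-trans (∑-sample (suc x) J q μ (≤-reflexive (suc-pred q)) (Jq+x<n x<m)) t-near)
          where
          rearrange : ∀ q′ s x → suc q′ + s + x ≡ suc x + (s + q′)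
          rearrange = solve-∀
          next : ∀ j → suc j * q + x ≡ suc x + (j * q + pred q)
          next j = trans (cong (λ r → r + j * q + x) (sym (suc-pred q))) (rearrange (pred q) (j * q) x)

-- Numerical estimates.

-- The bound on the text length enters here: it yields long overlaps, and two outer windows that
-- cover the text.
twice-start≤ : ∀ {m n i} → 2 * n ≤ 3 * m → i + m ≤ n → i + i ≤ m
twice-start≤ {m} {n} {i} 2n≤3m i+m≤n = +-cancelʳ-≤ (2 * m) (i + i) m (begin
  i + i + 2 * m     ≡⟨ double i m ⟩
  2 * (i + m)       ≤⟨ *-monoʳ-≤ 2 i+m≤n ⟩
  2 * n             ≤⟨ 2n≤3m ⟩
  3 * m             ∎)
  where
  open ≤-Reasoning
  double : ∀ i m → i + i + 2 * m ≡ 2 * (i + m)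
  double = solve-∀

-- From `i ≤ L` the overlap is at least half of `m`.
overlap-long : ∀ {m i L d q} → i + i ≤ m → i + L ≡ m → q * (8 * d) ≤ m → 4 * d * q ≤ L
overlap-long {i = i} {L} {d} {q} 2i≤m refl 8dq≤m = *-cancelˡ-≤ 2 (begin
  2 * (4 * d * q)   ≡⟨ double d q ⟩
  q * (8 * d)       ≤⟨ 8dq≤m ⟩
  i + L             ≤⟨ +-monoˡ-≤ L (+-cancelˡ-≤ i i L 2i≤m) ⟩
  L + L             ≡⟨ cong (L +_) (+-identityʳ L) ⟨
  2 * L             ∎)
  where
  open ≤-Reasoning
  double : ∀ d q → 2 * (4 * d * q) ≡ q * (8 * d)
  double = solve-∀

-- The left side is the run bound for `b = 3 * d`. Since 1 and `d` are at most `d * d`, the constant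
-- is 1 + 6 + 6.
linear+quadratic≤ : ∀ {d} → 0 < d →
                    suc ((3 * d + 3 * d) + (d * (3 * d) + d * (3 * d))) ≤ 13 * (d * d)
linear+quadratic≤ {d} 0<d = begin
  suc ((3 * d + 3 * d) + (d * (3 * d) + d * (3 * d)))   ≡⟨ collect d ⟩
  1 + 6 * d + 6 * (d * d)                               ≤⟨ +-monoˡ-≤ (6 * (d * d)) (+-mono-≤ (*-mono-≤ 0<d 0<d) (*-monoʳ-≤ 6 d≤d²)) ⟩
  d * d + 6 * (d * d) + 6 * (d * d)                     ≡⟨ total (d * d) ⟩
  13 * (d * d)                                          ∎
  where
  open ≤-Reasoning
  d≤d² : d ≤ d * d
  d≤d² = ≤-trans (≤-reflexive (sym (*-identityʳ d))) (*-monoʳ-≤ d 0<d)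
  collect : ∀ d → suc ((3 * d + 3 * d) + (d * (3 * d) + d * (3 * d))) ≡ 1 + 6 * d + 6 * (d * d)
  collect = solve-∀
  total : ∀ s → s + 6 * s + 6 * s ≡ 13 * s
  total = solve-∀

-- Assembling the three claims.

theorem5 : ∃[ C ] ∀ {A : Set} (_≟_ : DecidableEquality A) → let open Hamming _≟_ in
    ∀ (m n k : ℕ) (P : Vec A m) (T : Vec A n) →
    2 * n ≤ 3 * m →
    k ≤ m →
    Occ k P T 0 →
    Occ k P T (n ∸ m) →
    ∀ (d q : ℕ) .{{_ : NonZero q}} (Q : Vec A q) →
    0 < d →
    2 * k ≤ d →
    Primitive Q →
    q * (8 * d) ≤ m →
    δH P (Q ^∞[0⋯ m ]) ≤ d →
    (∀ i → Occ k P T i → q ∣ i)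
    × δH T (Q ^∞[0⋯ n ]) ≤ 3 * d
    × Σ[ ps ∈ List AP ] (DecomposesInto (Occ k P T) q ps × length ps ≤ C * (d * d))
theorem5 = 13 , proof
  where
  proof : ∀ {A : Set} (_≟_ : DecidableEquality A) → let open Hamming _≟_ in
    ∀ (m n k : ℕ) (P : Vec A m) (T : Vec A n) → 2 * n ≤ 3 * m → k ≤ m →
    Occ k P T 0 → Occ k P T (n ∸ m) →
    ∀ (d q : ℕ) .{{_ : NonZero q}} (Q : Vec A q) → 0 < d → 2 * k ≤ d → Primitive Q →
    q * (8 * d) ≤ m → δH P (Q ^∞[0⋯ m ]) ≤ d →
    (∀ i → Occ k P T i → q ∣ i)
    × δH T (Q ^∞[0⋯ n ]) ≤ 3 * d
    × Σ[ ps ∈ List AP ] (DecomposesInto (Occ k P T) q ps × length ps ≤ 13 * (d * d))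
  proof _≟_ m n k P T 2n≤3m _ occ₀ occₙ d q Q 0<d 2k≤d prim 8dq≤m P-near =
    multiple
    , subst (_≤ 3 * d) (sym (δH-^∞ a T Q)) T-near
    , ps , (((λ occ → sub (to occ)) , λ x∈ → from (sup x∈)) , disjoint)
    , ≤-trans len (≤-trans (s≤s (events-total {J = J} fits T-near)) (linear+quadratic≤ 0<d))
    where
    open Hamming _≟_
    open Mismatches _≟_
    -- The default letter for `extend`, available because `Q` is nonempty.
    a = (Q ^∞) 0
    p = extend a P
    t = extend a T
    open NearPeriodic p t (Q ^∞) (^∞-periodic Q) m n k d (subst (_≤ d) (δH-^∞ a P Q) P-near)

    occ⇒dist : ∀ {i} → Occ k P T i → dist i ≤ k
    occ⇒dist {i} (h , le) = subst (_≤ k) (δH-fragment a P T i h) le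

    occ⇒period : ∀ {i} → Occ k P T i → Periodic i (Q ^∞)
    occ⇒period {i} occ = occurrence-period 0<d 2k≤d i+L≡m
      (overlap-long {d = d} 2i≤m i+L≡m 8dq≤m) (occ⇒dist occ₀) (occ⇒dist occ)
      where
      2i≤m  = twice-start≤ 2n≤3m (proj₁ occ)
      i+L≡m = m+[n∸m]≡n (≤-trans (m≤m+n i i) 2i≤m)

    multiple : ∀ i → Occ k P T i → q ∣ i
    multiple i occ = primitive-period Q prim (occ⇒period occ)

    n∸m+m≡n : n ∸ m + m ≡ n
    n∸m+m≡n = m∸n+n≡m (proj₁ occ₀)

    T-near : ∑[ x < n ] mis (t x) ((Q ^∞) x) ≤ 3 * d
    T-near = text-near 2k≤d n∸m+m≡n
      (≤-trans (m≤m+n (n ∸ m) (n ∸ m)) (twice-start≤ 2n≤3m (proj₁ occₙ)))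
      (occ⇒period occₙ) (occ⇒dist occ₀) (occ⇒dist occₙ)

    J : ℕ
    -- The last possible start `n ∸ m` is an occurrence, hence a multiple of `q`, so the shifts by
    -- `q` end exactly there.
    J = quotient (multiple (n ∸ m) occₙ)

    fits : J * q + m ≡ n
    fits = trans (cong (_+ m) (sym (_∣_.equality (multiple (n ∸ m) occₙ)))) n∸m+m≡n

    D? : ∀ j → Dec (dist (j * q) ≤ k)
    D? j = dist (j * q) ≤? k

    to : ∀ {x} → Occ k P T x → MultiplesUpTo D? q J x
    to {x} occ with multiple x occ
    ... | divides j refl = j , j≤J , occ⇒dist occ , refl
      where
      j≤J : j ≤ J
      j≤J = *-cancelʳ-≤ j J q (+-cancelʳ-≤ m (j * q) (J * q)
        (≤-trans (proj₁ occ) (≤-reflexive (sym fits))))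

    from : ∀ {x} → MultiplesUpTo D? q J x → Occ k P T x
    from (j , j≤J , le , refl) = h , subst (_≤ k) (sym (δH-fragment a P T (j * q) h)) le
      where
      h : j * q + m ≤ n
      h = ≤-trans (+-monoˡ-≤ m (*-monoˡ-≤ q j≤J)) (≤-reflexive fits)

    -- With no event at `j` the distance stays the same, so a non-occurrence cannot turn into an
    -- occurrence.
    decomposition = runs D? q J events λ j _ ¬Dj Dj′ →
      n≢0⇒n>0 λ none → ¬Dj (subst (_≤ k) (sym (dist-constant j none)) Dj′)
    ps       = proj₁ decomposition
    sub      = λ {x} → proj₁ (proj₁ (proj₁ (proj₂ decomposition))) {x}
    sup      = λ {x} → proj₂ (proj₁ (proj₁ (proj₂ decomposition))) {x}
    disjoint = proj₂ (proj₁ (proj₂ decomposition))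
    len      = proj₂ (proj₂ decomposition)
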